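{- There exist a fixed atomic Boolean conjunctive query $Q$ and a fixed set $\Sigma_u$ of TGDs, where all TGDs in $\Sigma_u$ are guarded except one, such that it is undecidable to determine, given a database $D$, whether $D\cup\Sigma_u\models Q$ or, equivalently, whether $\mathit{chase}(D,\Sigma_u)\models Q$.
   Context: Let $\Delta$ (constants), $\Delta_N$ (labeled nulls) and $\Delta_V$ (variables) be pairwise disjoint sets of symbols; distinct constants denote distinct values. A relational schema is a finite set of predicates with arities. An instance is a (possibly infinite) set of atoms over the schema with arguments in $\Delta\cup\Delta_N$; a database is a finite instance all of whose arguments are constants. A homomorphism is a mapping between the arguments of two sets of atoms that is the identity on constants and maps atoms of the first set to atoms of the second. A tuple-generating dependency (TGD) is a first-order sentence $\forall\mathbf X\forall\mathbf Y\,(\Phi(\mathbf X,\mathbf Y)\to\exists\mathbf Z\,\Psi(\mathbf X,\mathbf Z))$, where the body $\Phi$ is a conjunction of atoms and the head $\Psi$ is a single atom. A TGD is guarded if some body atom contains all the universally quantified variables $\mathbf X,\mathbf Y$ of the TGD. A Boolean conjunctive query (BCQ) is a finite set of atoms, read as the existential closure of their conjunction; it is atomic if it consists of one atom. For an instance $B$, $B\models Q$ iff there is a homomorphism from $Q$ to $B$. $D\cup\Sigma\models Q$ denotes first-order entailment over arbitrary (finite or infinite) models. Chase: a TGD $\sigma$ is applicable to an instance $B$ via a homomorphism $h$ if $h(\Phi)\subseteq B$; its application yields $B\cup h'(\Psi)$, where $h'$ extends $h|_{\mathbf X}$ by mapping each $Z\in\mathbf Z$ to a fresh null not occurring in $B$.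 $\mathit{chase}(D,\Sigma)$ is the limit of a fair (possibly infinite) sequence of such applications of TGDs in $\Sigma$ starting from $D$ (following a fixed deterministic strategy, the same pair $(\sigma,h)$ never being applied twice), where fair means that whenever $\sigma\in\Sigma$ is applicable to some element of the sequence via $h$, some later element contains $h'(\Psi)$ for an extension $h'$ of $h|_{\mathbf X}$. -}

module Defs where

open import Data.Fin using (Fin; toℕ)
open import Data.List using (List; []; _∷_; map)
open import Data.List.Membership.Propositional using (_∈_)
open import Data.List.Relation.Unary.All using (All)
open import Data.List.Relation.Unary.Any using (Any)
open import Data.Maybe using (Maybe; just; nothing)
open import Data.Nat using (ℕ; zero; suc; _+_; _<_)
open import Data.Product using (Σ-syntax; ∃-syntax; _×_; _,_)
open import Data.Sum using (_⊎_; [_,_]′)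
open import Data.Vec as Vec using (Vec; lookup; toList)
open import Data.Vec.Membership.Propositional using () renaming (_∈_ to _∈ᵛ_)
open import Function using (_∘_)
open import Function.Definitions using (Injective)
open import Relation.Binary.PropositionalEquality using (_≡_)
open import Relation.Nullary using (¬_)

------------------------------------------------------------------------
-- Undecidability, with Kleene's partial recursive functions as the model
-- of computation

data Rec : ℕ → Set where
  zeroᵣ : ∀ {n} → Rec n
  sucᵣ  : Rec 1
  proj  : ∀ {n} → Fin n → Rec n
  comp  : ∀ {m n} → Rec m → Vec (Rec n) m → Rec n
  prim  : ∀ {n} → Rec n → Rec (2 + n) → Rec (1 + n)
  mu    : ∀ {n} → Rec (1 + n) → Rec n

-- f [ xs ]⇓ y : the partial function f is defined at xs and has value y there.
-- Both recursion and minimisation work on the first argument; the step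
-- function of prim receives the counter, the previous value and the parameters.
mutual
  data _[_]⇓_ : ∀ {n} → Rec n → Vec ℕ n → ℕ → Set where
    zero⇓  : ∀ {n} {xs : Vec ℕ n} → zeroᵣ [ xs ]⇓ 0
    suc⇓   : ∀ {x} → sucᵣ [ x Vec.∷ Vec.[] ]⇓ suc x
    proj⇓  : ∀ {n} {xs : Vec ℕ n} {i} → proj i [ xs ]⇓ lookup xs i
    comp⇓  : ∀ {m n} {f : Rec m} {gs : Vec (Rec n) m} {xs ys z} →
             gs [ xs ]⇓* ys → f [ ys ]⇓ z → comp f gs [ xs ]⇓ z
    prim⇓₀ : ∀ {n} {f : Rec n} {g xs y} →
             f [ xs ]⇓ y → prim f g [ 0 Vec.∷ xs ]⇓ y
    prim⇓₊ : ∀ {n} {f : Rec n} {g k xs y z} →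
             prim f g [ k Vec.∷ xs ]⇓ y → g [ k Vec.∷ y Vec.∷ xs ]⇓ z →
             prim f g [ suc k Vec.∷ xs ]⇓ z
    mu⇓    : ∀ {n} {f : Rec (1 + n)} {xs y} →
             (∀ z → z < y → ∃[ w ] f [ z Vec.∷ xs ]⇓ suc w) →
             f [ y Vec.∷ xs ]⇓ 0 → mu f [ xs ]⇓ y

  data _[_]⇓*_ {n} : ∀ {m} → Vec (Rec n) m → Vec ℕ n → Vec ℕ m → Set where
    []⇓  : ∀ {xs} → Vec.[] [ xs ]⇓* Vec.[]
    _∷⇓_ : ∀ {m f xs y} {fs : Vec (Rec n) m} {ys} →
           f [ xs ]⇓ y → fs [ xs ]⇓* ys → (f Vec.∷ fs) [ xs ]⇓* (y Vec.∷ ys)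

-- The answers 1 and 0 mean "yes" and "no".
Decides : ∀ {a p} {A : Set a} → Rec 1 → (A → ℕ) → (A → Set p) → Set _
Decides f code P = ∀ x →
  (P x → f [ code x Vec.∷ Vec.[] ]⇓ 1) × (¬ P x → f [ code x Vec.∷ Vec.[] ]⇓ 0)

Undecidable : ∀ {a p} {A : Set a} → (A → ℕ) → (A → Set p) → Set _
Undecidable code P = ¬ (∃[ f ] Decides f code P)

triangle : ℕ → ℕ
triangle zero    = 0
triangle (suc n) = suc n + triangle n

-- Cantor's pairing bijection.
pair : ℕ → ℕ → ℕ
pair m n = triangle (m + n) + n

codeList : List ℕ → ℕ
codeList []       = 0
codeList (x ∷ xs) = suc (pair x (codeList xs))

------------------------------------------------------------------------
-- Atoms, databases, instances

Const Null : Set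
Const = ℕ
Null  = ℕ

record Schema : Set where
  field
    #preds : ℕ
    arity  : Fin #preds → ℕ

open Schema public

record Atom (S : Schema) (T : Set) : Set where
  constructor _·_
  field
    pred : Fin (#preds S)
    args : Vec T (arity S pred)

open Atom public

mapAtom : ∀ {S T U} → (T → U) → Atom S T → Atom S U
mapAtom f (p · ts) = p · Vec.map f ts

-- Arguments of atoms in instances.
data GTerm : Set where
  con  : Const → GTerm
  null : Null → GTerm

-- Arguments of atoms in queries and dependencies, with variables from V.
data Term (V : Set) : Set where
  con : Const → Term V
  var : V → Term V

eval : {V X : Set} → (Const → X) → (V → X) → Term V → X
eval c h (con a) = c a
eval c h (var x) = h x

-- The image of an atom under a homomorphism given by its values on variables.
ground : ∀ {S V} → (V → GTerm) → Atom S (Term V) → Atom S GTerm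
ground h = mapAtom (eval con h)

-- Finite sets are represented by lists; order and repetitions do not affect
-- their meaning.  A decider is given a database as any list of its atoms.
Database : Schema → Set
Database S = List (Atom S Const)

codeDatabase : ∀ {S} → Database S → ℕ
codeDatabase = codeList ∘ map (λ a → pair (toℕ (pred a)) (codeList (toList (args a))))

Instance : Schema → Set₁
Instance S = Atom S GTerm → Set

------------------------------------------------------------------------
-- Queries and dependencies

record BCQ (S : Schema) : Set where
  field
    #vars : ℕ
    atoms : List (Atom S (Term (Fin #vars)))

open BCQ public

Atomic : ∀ {S} → BCQ S → Set
Atomic Q = ∃[ a ] atoms Q ≡ a ∷ []

-- The universal variables 𝐗, 𝐘 are Fin #univ, those of 𝐗 being the ones that
-- occur in the head; the existential variables 𝐙 are Fin #exis.  As usual,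
-- every universal variable has to occur in the body.  This field is irrelevant
-- so that dependencies are equal whenever they are syntactically equal.
record TGD (S : Schema) : Set where
  field
    #univ : ℕ
    #exis : ℕ
    body  : List (Atom S (Term (Fin #univ)))
    head  : Atom S (Term (Fin #univ ⊎ Fin #exis))
    .safe : ∀ x → Any (λ a → var x ∈ᵛ args a) body

open TGD public using (#univ; #exis; body; head)

Guarded : ∀ {S} → TGD S → Set
Guarded σ = Any (λ a → ∀ x → var x ∈ᵛ args a) (body σ)

GuardedExceptOne : ∀ {S} → List (TGD S) → Set
GuardedExceptOne Γ =
  ∃[ σ ] σ ∈ Γ × ¬ Guarded σ × (∀ τ → τ ∈ Γ → τ ≡ σ ⊎ Guarded τ)

------------------------------------------------------------------------
-- First-order semantics

-- Constants are interpreted injectively because distinct constants denote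
-- distinct values; in particular the domain is nonempty.
record Structure (S : Schema) : Set₁ where
  field
    Dom          : Set
    ⟦_⟧          : Const → Dom
    ⟦⟧-injective : Injective _≡_ _≡_ ⟦_⟧
    Holds        : Atom S Dom → Set

open Structure public using (Dom; ⟦_⟧; Holds)

infix 4 _⊨ᴰ_ _⊨ᵀ_ _⊨ᵠ_

_⊨ᴰ_ : ∀ {S} → Structure S → Database S → Set
M ⊨ᴰ D = All (Holds M ∘ mapAtom (⟦_⟧ M)) D

_⊨ᵀ_ : ∀ {S} → Structure S → TGD S → Set
M ⊨ᵀ σ = (h : Vec (Dom M) (#univ σ)) →
  All (Holds M ∘ mapAtom (eval (⟦_⟧ M) (lookup h))) (body σ) →
  Σ[ z ∈ Vec (Dom M) (#exis σ) ]
    Holds M (mapAtom (eval (⟦_⟧ M) [ lookup h , lookup z ]′) (head σ))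

_⊨ᵠ_ : ∀ {S} → Structure S → BCQ S → Set
M ⊨ᵠ Q = Σ[ h ∈ Vec (Dom M) (#vars Q) ]
  All (Holds M ∘ mapAtom (eval (⟦_⟧ M) (lookup h))) (atoms Q)

Entails : ∀ {S} → Database S → List (TGD S) → BCQ S → Set₁
Entails D Γ Q = ∀ M → M ⊨ᴰ D → All (M ⊨ᵀ_) Γ → M ⊨ᵠ Q

------------------------------------------------------------------------
-- The chase

infix 4 _⊨_

_⊨_ : ∀ {S} → Instance S → BCQ S → Set
B ⊨ Q = Σ[ h ∈ Vec GTerm (#vars Q) ] All (B ∘ ground (lookup h)) (atoms Q)

FinInstance : Schema → Set
FinInstance S = List (Atom S GTerm)

Trigger : Schema → Set
Trigger S = Σ[ σ ∈ TGD S ] Vec GTerm (#univ σ)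

Applicable : ∀ {S} → Trigger S → FinInstance S → Set
Applicable (σ , h) B = All (λ a → ground (lookup h) a ∈ B) (body σ)

headImage : ∀ {S} ((σ , h) : Trigger S) → Vec GTerm (#exis σ) → Atom S GTerm
headImage (σ , h) z = ground [ lookup h , lookup z ]′ (head σ)

Fresh : ∀ {S} → Null → FinInstance S → Set
Fresh v B = All (λ a → ¬ (null v ∈ᵛ args a)) B

-- Idle steps accommodate finite chases: a terminating sequence is continued by
-- repeating its last element.
data Step {S} (Γ : List (TGD S)) (B : FinInstance S) :
          Maybe (Trigger S) → FinInstance S → Set where
  idle  : Step Γ B nothing B
  apply : ∀ {σ h} (z : Vec Null (#exis σ)) →
          σ ∈ Γ → Applicable (σ , h) B →
          (∀ i → Fresh (lookup z i) B) → Injective _≡_ _≡_ (lookup z) →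
          Step Γ B (just (σ , h)) (headImage (σ , h) (Vec.map null z) ∷ B)

record Chase {S} (D : Database S) (Γ : List (TGD S)) : Set where
  field
    stage   : ℕ → FinInstance S
    trigger : ℕ → Maybe (Trigger S)
    start   : stage 0 ≡ map (mapAtom con) D
    step    : ∀ n → Step Γ (stage n) (trigger n) (stage (suc n))
    once    : ∀ m n τ → trigger m ≡ just τ → trigger n ≡ just τ → m ≡ n
    fair    : ∀ n σ h → σ ∈ Γ → Applicable (σ , h) (stage n) →
              ∃[ m ] n < m × (∃[ z ] headImage (σ , h) z ∈ stage m)

  limit : Instance S
  limit a = ∃[ n ] a ∈ stage n

open Chase public using (limit)

-- A deterministic strategy: a choice of one chase for every database.
ChaseStrategy : ∀ {S} → List (TGD S) → Set
ChaseStrategy Γ = ∀ D → Chase D Γ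

{-# OPTIONS --safe #-}

-- One unguarded rule that combines any eight facts into a single wide atom makes
-- all further rules guarded, since their at most eight premises can be collected
-- in such an atom. So guardedness is no restriction, and rules can generate
-- Kleene's evaluation relation: programs are constants, namely Gödel numbers,
-- whose structure is listed in the database, and numbers and argument lists are
-- supplied by existential rules.
--
-- For undecidability, suppose that f decides entailment. Let g = f ∘ s, let n be
-- the code of the facts that describe g, and let D extend these facts by a
-- successor chain up to n, so that D entails the query iff g(n) = 0. Since coding
-- is a fold and the chain is put in front, s can compute the code of D from n by
-- primitive recursion, without decoding n. Hence g(n) = f(code D), and D entails
-- the query iff f says that it does not.
module Submission where

open import Data.Empty using (⊥; ⊥-elim; ⊥-elim-irr)
open import Data.Fin as Fin using (Fin; zero; suc; #_; toℕ; combine)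
open import Data.Fin.Properties as Fin using (all?; any?)
open import Data.List as List using (List; []; _∷_; _++_)
open import Data.List.Membership.Propositional using (_∈_)
open import Data.List.Membership.Propositional.Properties using (∈-lookup; ∈-map⁺; ∈-map⁻)
open import Data.List.Relation.Unary.All as All using (All; []; _∷_)
open import Data.List.Relation.Unary.All.Properties as All using (map⁺; map⁻; tabulate⁺)
open import Data.List.Relation.Unary.Any as Any using (Any; here; there)
open import Data.Nat as ℕ using (ℕ; zero; suc; _+_; _≤_; _<_; _⊔_; z≤n; s≤s)
open import Data.Nat.Properties as ℕ
  using (m≤m⊔n; m≤n⊔m; m≤m+n; m≤n+m; +-comm; +-mono-≤; +-monoʳ-<; +-cancelˡ-≡; +-cancelʳ-≡;
         suc-injective; <-cmp; <-irrefl; module ≤-Reasoning; m<1+n⇒m<n∨m≡n)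
open import Data.Product
open import Data.Sum using (_⊎_; inj₁; inj₂; [_,_]′)
open import Data.Unit using (⊤; tt)
open import Data.Vec as Vec using (Vec; []; _∷_; lookup; toList)
open import Data.Vec.Membership.Propositional using () renaming (_∈_ to _∈ᵛ_)
open import Data.Vec.Membership.Propositional.Properties using () renaming (∈-map⁺ to ∈ᵛ-map⁺)
open import Data.Vec.Properties as Vec
  using (lookup-concat; lookup-map; lookup∘tabulate; map-cong; map-∘; map-concat;
         tabulate-∘; tabulate-cong; tabulate∘lookup)
open import Data.Vec.Relation.Unary.Any as VecAny using (here; there)
open import Function using (_∘_)
open import Function.Bundles using (_⇔_; mk⇔; Equivalence)
open import Relation.Binary.Definitions using (tri<; tri≈; tri>)
open import Relation.Binary.PropositionalEquality
open import Relation.Nullary using (¬_; Dec; yes; no; contradiction)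
open import Relation.Nullary.Decidable using (True; toWitness; map′; from-yes; from-no)
open import Defs

-- Kleene evaluation and coding

mutual
  ⇓-deterministic : ∀ {n} {f : Rec n} {xs y z} → f [ xs ]⇓ y → f [ xs ]⇓ z → y ≡ z
  ⇓-deterministic zero⇓ zero⇓ = refl
  ⇓-deterministic suc⇓ suc⇓ = refl
  ⇓-deterministic proj⇓ proj⇓ = refl
  ⇓-deterministic (comp⇓ gs f) (comp⇓ gs′ f′)
    with refl ← ⇓*-deterministic gs gs′ = ⇓-deterministic f f′
  ⇓-deterministic (prim⇓₀ f) (prim⇓₀ f′) = ⇓-deterministic f f′
  ⇓-deterministic (prim⇓₊ f g) (prim⇓₊ f′ g′)
    with refl ← ⇓-deterministic f f′ = ⇓-deterministic g g′
  -- If the two results differ, one search stopped with 0 at the smaller of them, where the other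
  -- search found a positive value.
  ⇓-deterministic {y = y} {z} (mu⇓ below at) (mu⇓ below′ at′) with <-cmp y z
  ... | tri≈ _ y≡z _ = y≡z
  ... | tri< y<z _ _ with () ← ⇓-deterministic at (proj₂ (below′ y y<z))
  ... | tri> _ _ z<y with () ← ⇓-deterministic (proj₂ (below z z<y)) at′

  ⇓*-deterministic : ∀ {m n} {fs : Vec (Rec n) m} {xs ys zs} →
                     fs [ xs ]⇓* ys → fs [ xs ]⇓* zs → ys ≡ zs
  ⇓*-deterministic []⇓ []⇓ = refl
  ⇓*-deterministic (d ∷⇓ ds) (d′ ∷⇓ ds′) =
    cong₂ _∷_ (⇓-deterministic d d′) (⇓*-deterministic ds ds′)

triangle-mono : ∀ {m n} → m ≤ n → triangle m ≤ triangle n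
triangle-mono z≤n       = z≤n
triangle-mono (s≤s m≤n) = +-mono-≤ (s≤s m≤n) (triangle-mono m≤n)

-- The codes on diagonal `s` lie between `triangle s` and `triangle s + s`, so a later diagonal
-- begins only after an earlier one has ended.
pair-diagonal : ∀ a b c d → a + b < c + d → pair a b < pair c d
pair-diagonal a b c d a+b<c+d = begin-strict
  triangle (a + b) + b           <⟨ +-monoʳ-< (triangle (a + b)) (s≤s (m≤n+m b a)) ⟩
  triangle (a + b) + suc (a + b) ≡⟨ +-comm (triangle (a + b)) _ ⟩
  triangle (suc (a + b))         ≤⟨ triangle-mono a+b<c+d ⟩
  triangle (c + d)               ≤⟨ m≤m+n _ d ⟩
  triangle (c + d) + d           ∎
  where open ≤-Reasoning

pair-injective : ∀ {a b c d} → pair a b ≡ pair c d → a ≡ c × b ≡ d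
pair-injective {a} {b} {c} {d} eq with <-cmp (a + b) (c + d)
... | tri< lt _ _ = ⊥-elim (<-irrefl eq (pair-diagonal a b c d lt))
... | tri> _ _ gt = ⊥-elim (<-irrefl (sym eq) (pair-diagonal c d a b gt))
... | tri≈ _ sum≡ _ = +-cancelʳ-≡ b a c (trans sum≡ (cong (c +_) (sym b≡d))) , b≡d
  where
  b≡d : b ≡ d
  b≡d = +-cancelˡ-≡ (triangle (a + b)) b d (trans eq (cong (λ s → triangle s + d) (sym sum≡)))

codeList-injective : ∀ {xs ys} → codeList xs ≡ codeList ys → xs ≡ ys
codeList-injective {[]}     {[]}     _  = refl
codeList-injective {x ∷ xs} {y ∷ ys} eq with pair-injective (suc-injective eq)
... | x≡y , eq′ = cong₂ _∷_ x≡y (codeList-injective eq′)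

-- Recursive functions for addition, pairing and list cells

constᵣ : ∀ {n} → ℕ → Rec n
constᵣ zero    = zeroᵣ
constᵣ (suc k) = comp sucᵣ (constᵣ k ∷ [])

addᵣ : Rec 2
addᵣ = prim (proj (# 0)) (comp sucᵣ (proj (# 1) ∷ []))

triangleᵣ : Rec 1
triangleᵣ = prim zeroᵣ (comp sucᵣ (comp addᵣ (proj (# 0) ∷ proj (# 1) ∷ []) ∷ []))

pairᵣ : Rec 2
pairᵣ = comp addᵣ (comp triangleᵣ (addᵣ ∷ []) ∷ proj (# 1) ∷ [])

constᵣ⇓ : ∀ {n} {xs : Vec ℕ n} k → constᵣ k [ xs ]⇓ k
constᵣ⇓ zero    = zero⇓
constᵣ⇓ (suc k) = comp⇓ (constᵣ⇓ k ∷⇓ []⇓) suc⇓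

addᵣ⇓ : ∀ x y → addᵣ [ x ∷ y ∷ [] ]⇓ (x + y)
addᵣ⇓ zero    y = prim⇓₀ proj⇓
addᵣ⇓ (suc x) y = prim⇓₊ (addᵣ⇓ x y) (comp⇓ (proj⇓ ∷⇓ []⇓) suc⇓)

triangleᵣ⇓ : ∀ n → triangleᵣ [ n ∷ [] ]⇓ triangle n
triangleᵣ⇓ zero    = prim⇓₀ zero⇓
triangleᵣ⇓ (suc n) = prim⇓₊ (triangleᵣ⇓ n)
  (comp⇓ (comp⇓ (proj⇓ ∷⇓ (proj⇓ ∷⇓ []⇓)) (addᵣ⇓ n (triangle n)) ∷⇓ []⇓) suc⇓)

pairᵣ⇓ : ∀ x y → pairᵣ [ x ∷ y ∷ [] ]⇓ pair x y
pairᵣ⇓ x y = comp⇓ (comp⇓ (addᵣ⇓ x y ∷⇓ []⇓) (triangleᵣ⇓ (x + y)) ∷⇓ (proj⇓ ∷⇓ []⇓))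
                   (addᵣ⇓ (triangle (x + y)) y)

infixr 5 _∷ᵣ_
_∷ᵣ_ : ∀ {n} → Rec n → Rec n → Rec n
f ∷ᵣ g = comp sucᵣ (comp pairᵣ (f ∷ g ∷ []) ∷ [])

∷ᵣ⇓ : ∀ {n f g} {xs : Vec ℕ n} {y z} → f [ xs ]⇓ y → g [ xs ]⇓ z → (f ∷ᵣ g) [ xs ]⇓ suc (pair y z)
∷ᵣ⇓ f⇓ g⇓ = comp⇓ (comp⇓ (f⇓ ∷⇓ (g⇓ ∷⇓ []⇓)) (pairᵣ⇓ _ _) ∷⇓ []⇓) suc⇓

-- The chase is a universal model

private variable
  S : Schema
  D : Database S
  Γ : List (TGD S)

mapAtom-∘ : ∀ {T U V} (f : U → V) (g : T → U) (h : T → V) → (∀ t → f (g t) ≡ h t) →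
            (a : Atom S T) → mapAtom f (mapAtom g a) ≡ mapAtom h a
mapAtom-∘ f g h eq (p · ts) = cong (p ·_) (trans (sym (map-∘ f g ts)) (map-cong eq ts))

stage-mono : (C : Chase D Γ) → ∀ {m n} → m ≤ n → ∀ {a} → a ∈ Chase.stage C m → a ∈ Chase.stage C n
stage-mono C m≤n a∈ = go (ℕ.≤⇒≤′ m≤n) a∈
  where
  grows : ∀ {B t B′} → Step Γ B t B′ → ∀ {a} → a ∈ B → a ∈ B′
  grows idle              = λ a∈ → a∈
  grows (apply _ _ _ _ _) = there

  go : ∀ {m n} → m ℕ.≤′ n → ∀ {a} → a ∈ Chase.stage C m → a ∈ Chase.stage C n
  go ℕ.≤′-refl       a∈ = a∈
  go (ℕ.≤′-step m≤n) a∈ = grows (Chase.step C _) (go m≤n a∈)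

-- Stages only grow and the list is finite, so the maximum of the individual stages works for all
-- atoms.
common-stage : (C : Chase D Γ) {X : Set} {f : X → Atom S GTerm} {xs : List X} →
               All (limit C ∘ f) xs → ∃[ n ] All (λ x → f x ∈ Chase.stage C n) xs
common-stage C [] = 0 , []
common-stage C ((m , p) ∷ ps) with common-stage C ps
... | n , qs = m ⊔ n , stage-mono C (m≤m⊔n m n) p ∷ All.map (stage-mono C (m≤n⊔m m n)) qs

limitStructure : Chase {S} D Γ → Structure S
limitStructure C = record
  { Dom = GTerm ; ⟦_⟧ = con ; ⟦⟧-injective = λ { refl → refl } ; Holds = limit C }

limit⊨ᴰ : (C : Chase D Γ) → limitStructure C ⊨ᴰ D
limit⊨ᴰ {D = D} C = map⁻ {f = mapAtom con} (All.tabulate {P = limit C} λ {a} a∈ →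
  0 , subst (a ∈_) (sym (Chase.start C)) a∈)

-- Fairness speaks of single stages, so the whole body is first moved into one of them.
limit⊨ᵀ : (C : Chase D Γ) → All (limitStructure C ⊨ᵀ_) Γ
limit⊨ᵀ C = All.tabulate λ {σ} σ∈Γ h body →
  let n , applicable = common-stage C body
      m , _ , z , head∈ = Chase.fair C n σ h σ∈Γ applicable
  in z , m , head∈

-- The nulls introduced by a chase step are fresh, so that a homomorphism into a
-- model can be redefined on them; .safe guarantees that the universal
-- variables of the head keep their values.
module _ (M : Structure S) where

  extend : (Null → Dom M) → GTerm → Dom M
  extend g (con a)  = ⟦ M ⟧ a
  extend g (null v) = g v

  ground-extend : ∀ {n} g (h : Vec GTerm n) (a : Atom S (Term (Fin n))) →
                  mapAtom (extend g) (ground (lookup h) a) ≡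
                  mapAtom (eval ⟦ M ⟧ (lookup (Vec.map (extend g) h))) a
  ground-extend g h = mapAtom-∘ (extend g) _ _ λ where
    (con _) → refl
    (var x) → sym (lookup-map x (extend g) h)

  IsHom : FinInstance S → (Null → Dom M) → Set
  IsHom B g = All (Holds M ∘ mapAtom (extend g)) B

  override : ∀ {k} → (Null → Dom M) → Vec Null k → Vec (Dom M) k → Null → Dom M
  override g z d v with any? (λ i → lookup z i ℕ.≟ v)
  ... | yes (i , _) = lookup d i
  ... | no _        = g v

  override-∈ : ∀ {k} (g : Null → Dom M) (z : Vec Null k) (d : Vec (Dom M) k) →
               (∀ {i j} → lookup z i ≡ lookup z j → i ≡ j) →
               ∀ i → override g z d (lookup z i) ≡ lookup d i
  override-∈ g z d inj i with any? (λ j → lookup z j ℕ.≟ lookup z i)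
  ... | yes (j , eq) = cong (lookup d) (inj eq)
  ... | no ¬∃        = contradiction (i , refl) ¬∃

  override-∉ : ∀ {k} (g : Null → Dom M) (z : Vec Null k) (d : Vec (Dom M) k) (t : GTerm) →
               (∀ i → ¬ t ≡ null (lookup z i)) →
               extend (override g z d) t ≡ extend g t
  override-∉ g z d (con _)  _ = refl
  override-∉ g z d (null v) fresh with any? (λ i → lookup z i ℕ.≟ v)
  ... | yes (i , eq) = contradiction (cong null (sym eq)) (fresh i)
  ... | no _         = refl

  mapAtom-cong-∈ : ∀ {T U} {f g : T → U} (a : Atom S T) →
                   (∀ {t} → t ∈ᵛ args a → f t ≡ g t) → mapAtom f a ≡ mapAtom g a
  mapAtom-cong-∈ {f = f} {g} (p · ts) eq = cong (p ·_) (go ts eq)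
    where
    go : ∀ {k} (ts : Vec _ k) → (∀ {t} → t ∈ᵛ ts → f t ≡ g t) → Vec.map f ts ≡ Vec.map g ts
    go []       eq = refl
    go (t ∷ ts) eq = cong₂ _∷_ (eq (here refl)) (go ts (eq ∘ there))

  hom-step : ∀ {B t B′} → All (M ⊨ᵀ_) Γ → Step Γ B t B′ →
             ∃[ g ] IsHom B g → ∃[ g ] IsHom B′ g
  hom-step M⊨Γ idle hom = hom
  hom-step {B = B} M⊨Γ (apply {σ = σ@record { safe = safe }} {h} z σ∈Γ app fresh inj) (g , hom) =
    g′ , subst (Holds M) (sym head≡) holds ∷ All.tabulate λ {a} a∈ →
      subst (Holds M) (sym (old≡ a a∈)) (All.lookup hom a∈)
    where
    h′ = Vec.map (extend g) h

    body′ : All (Holds M ∘ mapAtom (eval ⟦ M ⟧ (lookup h′))) (body σ)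
    body′ = All.map (λ {a} a∈ → subst (Holds M) (ground-extend g h a) (All.lookup hom a∈)) app

    -- The model satisfies `σ` at the image of the trigger; the witnesses `d` become the values of
    -- the fresh nulls.
    d     = proj₁ (All.lookup M⊨Γ σ∈Γ h′ body′)
    holds = proj₂ (All.lookup M⊨Γ σ∈Γ h′ body′)
    g′    = override g z d

    old≡ : ∀ a → a ∈ B → mapAtom (extend g′) a ≡ mapAtom (extend g) a
    old≡ a a∈ = mapAtom-cong-∈ a λ {t} t∈ → override-∉ g z d t λ i t≡ →
      All.lookup (fresh i) a∈ (subst (_∈ᵛ args a) t≡ t∈)

    -- The image of the body lies in `B`, so the value of a variable of the body occurs in `B`,
    -- unlike a fresh null.
    occurs⇒stale : ∀ {x i as} → Any (λ a → var x ∈ᵛ args a) as →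
                   All (λ a → ground (lookup h) a ∈ B) as →
                   lookup h x ≡ null (lookup z i) → ⊥
    occurs⇒stale {i = i} (here x∈) (a∈ ∷ _) h≡ =
      All.lookup (fresh i) a∈ (subst (_∈ᵛ _) h≡ (∈ᵛ-map⁺ (eval con (lookup h)) x∈))
    occurs⇒stale (there x∈) (_ ∷ as∈) h≡ = occurs⇒stale x∈ as∈ h≡

    pushed : ∀ t → extend g′ (eval con [ lookup h , lookup (Vec.map null z) ]′ t)
                 ≡ eval ⟦ M ⟧ [ lookup h′ , lookup d ]′ t
    pushed (con _)        = refl
    pushed (var (inj₁ x)) = trans
      -- The field `safe` is irrelevant, so it may only be used to derive a contradiction.
      (override-∉ g z d (lookup h x) λ i h≡ → ⊥-elim-irr (occurs⇒stale (safe x) app h≡))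
      (sym (lookup-map x (extend g) h))
    pushed (var (inj₂ i)) = trans (cong (extend g′) (lookup-map i null z)) (override-∈ g z d inj i)

    head≡ = mapAtom-∘ (extend g′) (eval con [ lookup h , lookup (Vec.map null z) ]′)
                      (eval ⟦ M ⟧ [ lookup h′ , lookup d ]′) pushed (head σ)

  hom-stage : All (M ⊨ᵀ_) Γ → M ⊨ᴰ D → (C : Chase D Γ) → ∀ n → ∃[ g ] IsHom (Chase.stage C n) g
  hom-stage {D = D} M⊨Γ M⊨D C zero =
    -- The database has no nulls, so any default value will do.
    (λ _ → ⟦ M ⟧ 0) , subst (All _) (sym (Chase.start C))
      (map⁺ (All.map (λ {a} → subst (Holds M) (sym (mapAtom-∘ _ _ _ (λ _ → refl) a))) M⊨D))
  hom-stage M⊨Γ M⊨D C (suc n) = hom-step M⊨Γ (Chase.step C n) (hom-stage M⊨Γ M⊨D C n)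

-- The limit is itself a model. Conversely, a match in the limit lies in a finite stage, from which
-- a homomorphism carries it into any model.
entails⇔chase : (D : Database S) (Γ : List (TGD S)) (Q : BCQ S) (C : Chase D Γ) →
                Entails D Γ Q ⇔ (limit C ⊨ Q)
entails⇔chase D Γ Q C = mk⇔ (λ entails → entails (limitStructure C) (limit⊨ᴰ C) (limit⊨ᵀ C)) from
  where
  from : limit C ⊨ Q → Entails D Γ Q
  from (h , Q∈) M M⊨D M⊨Γ =
    let n , Q∈ₙ = common-stage C Q∈
        g , hom = hom-stage M M⊨Γ M⊨D C n
    in Vec.map (extend M g) h ,
       All.map (λ {a} a∈ → subst (Holds M) (ground-extend M g h a) (All.lookup hom a∈)) Q∈ₙ

-- The dependencies

-- The longest rule, `prim-eval₊`, has eight premises.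
facts-per-rule : ℕ
facts-per-rule = 8

Row : Set → Set
Row T = Vec T 4

𝕊 : Schema
𝕊 = record { #preds = 2 ; arity = λ { zero → 4 ; (suc _) → facts-per-rule ℕ.* 3 } }

-- The first argument of a fact is a tag that plays the role of a predicate; places
-- that are not needed repeat an argument. A guard atom lists the arguments of
-- eight facts, without their tags.
pattern fact r = zero · r
pattern guard ts = suc zero · ts

pattern obj    = 0
pattern succ   = 1
pattern cons   = 2
pattern zeroᵖ  = 3
pattern sucᵖ   = 4
pattern projᵖ  = 5
pattern projᵖ⁺ = 6
pattern compᵖ  = 7
pattern primᵖ  = 8
pattern muᵖ    = 9
pattern nilᵖ   = 10
pattern consᵖ  = 11
pattern eval₁  = 12
pattern eval*  = 13
pattern search = 14
pattern start  = 15
pattern input  = 16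
pattern goal   = 17

row₁ : ∀ {T} → T → T → Row T
row₁ t x = t ∷ x ∷ x ∷ x ∷ []

row₂ : ∀ {T} → T → T → T → Row T
row₂ t x y = t ∷ x ∷ y ∷ y ∷ []

row₃ : ∀ {T} → T → T → T → T → Row T
row₃ t x y z = t ∷ x ∷ y ∷ z ∷ []

-- obj 0 is a fact of all databases for which completeness is needed.
padded : ∀ {V k} → List (Row (Term V)) → Fin k → Row (Term V)
padded []       _       = row₁ (con obj) (con 0)
padded (r ∷ rs) zero    = r
padded (r ∷ rs) (suc i) = padded rs i

guardArgs : ∀ {T} → (Fin facts-per-rule → Row T) → Vec T (facts-per-rule ℕ.* 3)
guardArgs rs = Vec.concat (Vec.tabulate (Vec.tail ∘ rs))

map-guardArgs : ∀ {T U} (f : T → U) (rs : Fin facts-per-rule → Row T) →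
                Vec.map f (guardArgs rs) ≡ guardArgs (Vec.map f ∘ rs)
map-guardArgs f rs = begin
  Vec.map f (guardArgs rs)
    ≡⟨ map-concat f (Vec.tabulate (Vec.tail ∘ rs)) ⟩
  Vec.concat (Vec.map (Vec.map f) (Vec.tabulate (Vec.tail ∘ rs)))
    ≡⟨ cong Vec.concat (tabulate-∘ (Vec.map f) (Vec.tail ∘ rs)) ⟨
  Vec.concat (Vec.tabulate (Vec.map f ∘ Vec.tail ∘ rs))
    ≡⟨ cong Vec.concat (tabulate-cong (map-tail ∘ rs)) ⟩
  guardArgs (Vec.map f ∘ rs) ∎
  where
  open ≡-Reasoning
  map-tail : ∀ r → Vec.map f (Vec.tail r) ≡ Vec.tail (Vec.map f r)
  map-tail (_ ∷ _) = refl

infix 4 _≟ᵗ_ _∈?_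
_≟ᵗ_ : ∀ {n} (s t : Term (Fin n)) → Dec (s ≡ t)
con a ≟ᵗ con b = map′ (cong con) (λ { refl → refl }) (a ℕ.≟ b)
var x ≟ᵗ var y = map′ (cong var) (λ { refl → refl }) (x Fin.≟ y)
con _ ≟ᵗ var _ = no λ ()
var _ ≟ᵗ con _ = no λ ()

_∈?_ : ∀ {n k} (s : Term (Fin n)) (ts : Vec (Term (Fin n)) k) → Dec (s ∈ᵛ ts)
s ∈? ts = VecAny.any? (s ≟ᵗ_) ts

-- A rule without its guard. Bodies and heads are functions of the vector of variables, so that
-- rules can name these by pattern matching. For a concrete rule, `covered` is found by evaluation;
-- it yields both guardedness and safety.
record Clause : Set where
  constructor clause
  field
    #∀ #∃  : ℕ
    bodyOf : Vec (Term (Fin #∀)) #∀ → List (Row (Term (Fin #∀)))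
    headOf : let T = Term (Fin #∀ ⊎ Fin #∃) in Vec T #∀ → Vec T #∃ → Row T

  premises : List (Row (Term (Fin #∀)))
  premises = bodyOf (Vec.tabulate var)

  conclusion : Row (Term (Fin #∀ ⊎ Fin #∃))
  conclusion = headOf (Vec.tabulate (var ∘ inj₁)) (Vec.tabulate (var ∘ inj₂))

  field
    {covered} : True (all? λ x → var x ∈? guardArgs (padded premises))

  guarded : ∀ x → var x ∈ᵛ guardArgs (padded premises)
  guarded = toWitness covered

  tgd : TGD 𝕊
  tgd = record
    { #univ = #∀
    ; #exis = #∃
    -- The premises are repeated next to the guard, which omits their tags; the guard thus adds no
    -- content, and soundness may take all guard atoms to be true.
    ; body  = guard (guardArgs (padded premises)) ∷ List.map fact premises
    ; head  = fact conclusion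
    ; safe  = λ x → here (guarded x)
    }

open Clause

data Rule : Set where
  succ-exists succ-obj cons-exists cons-obj : Rule
  zero-eval suc-eval proj-eval proj⁺-eval nil-eval cons-eval comp-eval : Rule
  prim-eval₀ prim-eval₊ search-start search-step mu-eval accept : Rule

-- The constant 0 stands both for the number zero and for the empty list.
pattern 𝟘 = con 0

-- A fact `eval₁ p l y` says that program `p` maps the argument list `l` to `y`; `eval*` says the
-- same of a list of programs and the list of their values.
clauseOf : Rule → Clause
clauseOf succ-exists = clause 1 1
  (λ { (x ∷ []) → row₁ (con obj) x ∷ [] })
  λ { (x ∷ []) (y ∷ []) → row₂ (con succ) x y }
clauseOf succ-obj = clause 2 0
  (λ { (x ∷ y ∷ []) → row₂ (con succ) x y ∷ [] })
  λ { (x ∷ y ∷ []) [] → row₁ (con obj) y }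
clauseOf cons-exists = clause 2 1
  (λ { (x ∷ l ∷ []) → row₁ (con obj) x ∷ row₁ (con obj) l ∷ [] })
  λ { (x ∷ l ∷ []) (m ∷ []) → row₃ (con cons) x l m }
clauseOf cons-obj = clause 3 0
  (λ { (x ∷ l ∷ m ∷ []) → row₃ (con cons) x l m ∷ [] })
  λ { (x ∷ l ∷ m ∷ []) [] → row₁ (con obj) m }
clauseOf zero-eval = clause 2 0
  (λ { (p ∷ l ∷ []) → row₁ (con zeroᵖ) p ∷ row₁ (con obj) l ∷ [] })
  λ { (p ∷ l ∷ []) [] → row₃ (con eval₁) p l 𝟘 }
clauseOf suc-eval = clause 4 0
  (λ { (p ∷ x ∷ y ∷ l ∷ []) →
    row₁ (con sucᵖ) p ∷ row₃ (con cons) x 𝟘 l ∷ row₂ (con succ) x y ∷ [] })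
  λ { (p ∷ x ∷ y ∷ l ∷ []) [] → row₃ (con eval₁) p l y }
clauseOf proj-eval = clause 4 0
  (λ { (p ∷ x ∷ l ∷ m ∷ []) → row₁ (con projᵖ) p ∷ row₃ (con cons) x l m ∷ [] })
  λ { (p ∷ x ∷ l ∷ m ∷ []) [] → row₃ (con eval₁) p m x }
-- Projection `i + 1` drops the first argument and continues as projection `i`.
clauseOf proj⁺-eval = clause 6 0
  (λ { (p ∷ q ∷ x ∷ l ∷ m ∷ y ∷ []) →
    row₂ (con projᵖ⁺) p q ∷ row₃ (con cons) x l m ∷ row₃ (con eval₁) q l y ∷ [] })
  λ { (p ∷ q ∷ x ∷ l ∷ m ∷ y ∷ []) [] → row₃ (con eval₁) p m y }
clauseOf nil-eval = clause 2 0
  (λ { (p ∷ l ∷ []) → row₁ (con nilᵖ) p ∷ row₁ (con obj) l ∷ [] })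
  λ { (p ∷ l ∷ []) [] → row₃ (con eval*) p l 𝟘 }
clauseOf cons-eval = clause 7 0
  (λ { (p ∷ f ∷ fs ∷ l ∷ y ∷ ys ∷ m ∷ []) →
    row₃ (con consᵖ) p f fs ∷ row₃ (con eval₁) f l y ∷ row₃ (con eval*) fs l ys ∷
    row₃ (con cons) y ys m ∷ [] })
  λ { (p ∷ f ∷ fs ∷ l ∷ y ∷ ys ∷ m ∷ []) [] → row₃ (con eval*) p l m }
clauseOf comp-eval = clause 6 0
  (λ { (p ∷ f ∷ gs ∷ l ∷ ys ∷ z ∷ []) →
    row₃ (con compᵖ) p f gs ∷ row₃ (con eval*) gs l ys ∷ row₃ (con eval₁) f ys z ∷ [] })
  λ { (p ∷ f ∷ gs ∷ l ∷ ys ∷ z ∷ []) [] → row₃ (con eval₁) p l z }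
clauseOf prim-eval₀ = clause 6 0
  (λ { (p ∷ f ∷ g ∷ l ∷ m ∷ y ∷ []) →
    row₃ (con primᵖ) p f g ∷ row₃ (con cons) 𝟘 l m ∷ row₃ (con eval₁) f l y ∷ [] })
  λ { (p ∷ f ∷ g ∷ l ∷ m ∷ y ∷ []) [] → row₃ (con eval₁) p m y }
clauseOf prim-eval₊ = clause 12 0
  (λ { (p ∷ f ∷ g ∷ k ∷ k⁺ ∷ l ∷ y ∷ z ∷ kl ∷ yl ∷ kyl ∷ k⁺l ∷ []) →
    row₃ (con primᵖ) p f g ∷ row₃ (con cons) k l kl ∷ row₃ (con eval₁) p kl y ∷
    row₃ (con cons) y l yl ∷ row₃ (con cons) k yl kyl ∷ row₃ (con eval₁) g kyl z ∷
    row₂ (con succ) k k⁺ ∷ row₃ (con cons) k⁺ l k⁺l ∷ [] })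
  λ { (p ∷ f ∷ g ∷ k ∷ k⁺ ∷ l ∷ y ∷ z ∷ kl ∷ yl ∷ kyl ∷ k⁺l ∷ []) [] →
    row₃ (con eval₁) p k⁺l z }
-- A fact `search f l k` records that `f` is positive at all numbers below `k`; it replaces the
-- universal premise of `mu⇓`, which a rule body cannot express.
clauseOf search-start = clause 3 0
  (λ { (p ∷ f ∷ l ∷ []) → row₂ (con muᵖ) p f ∷ row₁ (con obj) l ∷ [] })
  λ { (p ∷ f ∷ l ∷ []) [] → row₃ (con search) f l 𝟘 }
clauseOf search-step = clause 7 0
  (λ { (f ∷ l ∷ k ∷ k⁺ ∷ kl ∷ w ∷ w⁺ ∷ []) →
    row₃ (con search) f l k ∷ row₃ (con cons) k l kl ∷ row₃ (con eval₁) f kl w⁺ ∷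
    row₂ (con succ) w w⁺ ∷ row₂ (con succ) k k⁺ ∷ [] })
  λ { (f ∷ l ∷ k ∷ k⁺ ∷ kl ∷ w ∷ w⁺ ∷ []) [] → row₃ (con search) f l k⁺ }
clauseOf mu-eval = clause 5 0
  (λ { (p ∷ f ∷ l ∷ k ∷ kl ∷ []) →
    row₂ (con muᵖ) p f ∷ row₃ (con search) f l k ∷ row₃ (con cons) k l kl ∷
    row₃ (con eval₁) f kl 𝟘 ∷ [] })
  λ { (p ∷ f ∷ l ∷ k ∷ kl ∷ []) [] → row₃ (con eval₁) p l k }
clauseOf accept = clause 3 0
  (λ { (p ∷ x ∷ l ∷ []) →
    row₁ (con start) p ∷ row₁ (con input) x ∷ row₃ (con cons) x 𝟘 l ∷
    row₃ (con eval₁) p l 𝟘 ∷ [] })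
  λ { (p ∷ x ∷ l ∷ []) [] → row₁ (con goal) p }

rules : List Rule
rules = succ-exists ∷ succ-obj ∷ cons-exists ∷ cons-obj ∷ zero-eval ∷ suc-eval ∷ proj-eval ∷
  proj⁺-eval ∷ nil-eval ∷ cons-eval ∷ comp-eval ∷ prim-eval₀ ∷ prim-eval₊ ∷ search-start ∷
  search-step ∷ mu-eval ∷ accept ∷ []

∈-rules : ∀ ρ → ρ ∈ rules
∈-rules succ-exists  = ∈-lookup (# 0)
∈-rules succ-obj     = ∈-lookup (# 1)
∈-rules cons-exists  = ∈-lookup (# 2)
∈-rules cons-obj     = ∈-lookup (# 3)
∈-rules zero-eval    = ∈-lookup (# 4)
∈-rules suc-eval     = ∈-lookup (# 5)
∈-rules proj-eval    = ∈-lookup (# 6)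
∈-rules proj⁺-eval   = ∈-lookup (# 7)
∈-rules nil-eval     = ∈-lookup (# 8)
∈-rules cons-eval    = ∈-lookup (# 9)
∈-rules comp-eval    = ∈-lookup (# 10)
∈-rules prim-eval₀   = ∈-lookup (# 11)
∈-rules prim-eval₊   = ∈-lookup (# 12)
∈-rules search-start = ∈-lookup (# 13)
∈-rules search-step  = ∈-lookup (# 14)
∈-rules mu-eval      = ∈-lookup (# 15)
∈-rules accept       = ∈-lookup (# 16)

crossRow : Fin facts-per-rule → Row (Fin (facts-per-rule ℕ.* 4))
crossRow i = Vec.tabulate (combine i)

crossBody : List (Atom 𝕊 (Term (Fin (facts-per-rule ℕ.* 4))))
crossBody = List.tabulate (λ i → fact (Vec.map var (crossRow i)))

-- All 32 places of the eight facts carry different variables. As the tags are variables too, this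
-- one rule serves all combinations of facts.
cross : TGD 𝕊
cross = record
  { #univ = facts-per-rule ℕ.* 4
  ; #exis = 0
  ; body  = crossBody
  ; head  = guard (guardArgs (λ i → Vec.map (var ∘ inj₁) (crossRow i)))
  ; safe  = from-yes (all? λ x → Any.any? (λ a → var x ∈? args a) crossBody)
  }

Σᵤ : List (TGD 𝕊)
Σᵤ = cross ∷ List.map (tgd ∘ clauseOf) rules

Q : BCQ 𝕊
Q = record { #vars = 1 ; atoms = fact (row₁ (con goal) (var zero)) ∷ [] }

cross-unguarded : ¬ Guarded cross
cross-unguarded = from-no (Any.any? (λ a → all? λ x → var x ∈? args a) crossBody)

guardedExceptOne : GuardedExceptOne Σᵤ
guardedExceptOne = cross , here refl , cross-unguarded , λ
  { τ (here τ≡)  → inj₁ τ≡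
  ; τ (there τ∈) → inj₂ (is-guarded (∈-map⁻ _ τ∈)) }
  where
  is-guarded : ∀ {τ} → ∃[ ρ ] ρ ∈ rules × τ ≡ tgd (clauseOf ρ) → Guarded τ
  is-guarded (ρ , _ , refl) = here (guarded (clauseOf ρ))

-- Applying the dependencies

guardArgs-cong : ∀ {T} {rs ss : Fin facts-per-rule → Row T} →
                 (∀ i → rs i ≡ ss i) → guardArgs rs ≡ guardArgs ss
guardArgs-cong eq = cong Vec.concat (tabulate-cong λ i → cong Vec.tail (eq i))

-- The rows `qs` are concatenated into one assignment, in which `combine i j` is place `j` of row
-- `i`. The parameter `v` is `var` in the body of `cross` and `var ∘ inj₁` in its head.
crossRow-instance : ∀ {T U : Set} (f : U → T) (v : Fin (facts-per-rule ℕ.* 4) → U)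
                    (qs : Fin facts-per-rule → Row T) →
                    (∀ x → f (v x) ≡ lookup (Vec.concat (Vec.tabulate qs)) x) →
                    ∀ i → Vec.map f (Vec.map v (crossRow i)) ≡ qs i
crossRow-instance f v qs f∘v≡ i = begin
  Vec.map f (Vec.map v (crossRow i))    ≡⟨ map-∘ f v (crossRow i) ⟨
  Vec.map (f ∘ v) (crossRow i)          ≡⟨ tabulate-∘ (f ∘ v) (combine i) ⟨
  Vec.tabulate (f ∘ v ∘ combine i)      ≡⟨ tabulate-cong column ⟩
  Vec.tabulate (lookup (qs i))          ≡⟨ tabulate∘lookup (qs i) ⟩
  qs i                                  ∎
  where
  open ≡-Reasoning
  column : ∀ j → f (v (combine i j)) ≡ lookup (qs i) j
  column j = trans (f∘v≡ (combine i j)) (trans (lookup-concat (Vec.tabulate qs) i j)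
    (cong (λ r → lookup r j) (lookup∘tabulate qs i)))

module _ (M : Structure 𝕊) where

  at : ∀ {V} → (V → Dom M) → Row (Term V) → Row (Dom M)
  at h = Vec.map (eval ⟦ M ⟧ h)

  cross-fires : M ⊨ᵀ cross → (qs : Fin facts-per-rule → Row (Dom M)) →
                (∀ i → Holds M (fact (qs i))) → Holds M (guard (guardArgs qs))
  cross-fires M⊨cross qs holds = subst (λ ts → Holds M (guard ts)) head≡ (proj₂ applied)
    where
    h = Vec.concat (Vec.tabulate qs)

    applied = M⊨cross h (tabulate⁺ {f = λ i → fact (Vec.map var (crossRow i))} λ i →
      subst (λ r → Holds M (fact r)) (sym (crossRow-instance (eval ⟦ M ⟧ (lookup h)) var qs (λ _ → refl) i)) (holds i))

    σ : Term (Fin (facts-per-rule ℕ.* 4) ⊎ Fin 0) → Dom M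
    σ = eval ⟦ M ⟧ [ lookup h , lookup (proj₁ applied) ]′

    head≡ : Vec.map σ (guardArgs (λ i → Vec.map (var ∘ inj₁) (crossRow i))) ≡ guardArgs qs
    head≡ = trans (map-guardArgs σ (λ i → Vec.map (var ∘ inj₁) (crossRow i)))
      (guardArgs-cong (crossRow-instance σ (var ∘ inj₁) qs (λ _ → refl)))

  padded-holds : ∀ {V k} {h : V → Dom M} → Holds M (fact (row₁ (⟦ M ⟧ obj) (⟦ M ⟧ 0))) →
                 ∀ {rs} → All (Holds M ∘ fact ∘ at h) rs →
                 (i : Fin k) → Holds M (fact (at h (padded rs i)))
  padded-holds pad []       i       = pad
  padded-holds pad (p ∷ ps) zero    = p
  padded-holds pad (p ∷ ps) (suc i) = padded-holds pad ps i

  Valid : Clause → Set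
  Valid c = (h : Vec (Dom M) (#∀ c)) → All (Holds M ∘ fact ∘ at (lookup h)) (premises c) →
            Σ[ z ∈ Vec (Dom M) (#∃ c) ] Holds M (fact (at [ lookup h , lookup z ]′ (conclusion c)))

  valid⇒⊨ᵀ : ∀ c → Valid c → M ⊨ᵀ tgd c
  valid⇒⊨ᵀ c valid h (_ ∷ ps) = valid h (map⁻ ps)

  -- The guard atom comes from `cross`, applied to the premises and enough copies of `obj 0`.
  ⊨ᵀ⇒valid : Holds M (fact (row₁ (⟦ M ⟧ obj) (⟦ M ⟧ 0))) → M ⊨ᵀ cross →
             ∀ c → M ⊨ᵀ tgd c → Valid c
  ⊨ᵀ⇒valid pad M⊨cross c M⊨c h ps = M⊨c h (guard-holds ∷ map⁺ ps)
    where
    guard-holds = subst (λ ts → Holds M (guard ts))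
      (sym (map-guardArgs (eval ⟦ M ⟧ (lookup h)) (padded (premises c))))
      (cross-fires M⊨cross _ (padded-holds pad ps))

-- Gödel numbers and databases

-- Abstract because unfolding the codes of concrete lists takes exponential time.
abstract
  encode : List ℕ → ℕ
  encode = codeList

  encode-injective : ∀ {xs ys} → encode xs ≡ encode ys → xs ≡ ys
  encode-injective = codeList-injective

mutual
  -- The leading tag separates the constructors. Arities are not recorded: `zeroᵣ` has the same
  -- number at every arity.
  node : ∀ {n} → Rec n → List ℕ
  node zeroᵣ       = zeroᵖ ∷ []
  node sucᵣ        = sucᵖ ∷ []
  node (proj i)    = projᵖ ∷ toℕ i ∷ []
  node (comp f gs) = compᵖ ∷ gödel f ∷ gödel* gs ∷ []
  node (prim f g)  = primᵖ ∷ gödel f ∷ gödel g ∷ []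
  node (mu f)      = muᵖ ∷ gödel f ∷ []

  gödel : ∀ {n} → Rec n → ℕ
  gödel f = encode (node f)

  node* : ∀ {m n} → Vec (Rec n) m → List ℕ
  node* []       = nilᵖ ∷ []
  node* (f ∷ fs) = consᵖ ∷ gödel f ∷ gödel* fs ∷ []

  gödel* : ∀ {m n} → Vec (Rec n) m → ℕ
  gödel* fs = encode (node* fs)

mutual
  programRows : ∀ {n} → Rec n → List (Row ℕ)
  programRows zeroᵣ         = row₁ zeroᵖ (encode (zeroᵖ ∷ [])) ∷ []
  programRows sucᵣ          = row₁ sucᵖ (encode (sucᵖ ∷ [])) ∷ []
  programRows (proj i)      = projRows (toℕ i)
  programRows f@(comp g gs) =
    row₃ compᵖ (gödel f) (gödel g) (gödel* gs) ∷ programRows g ++ programRows* gs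
  programRows f@(prim g h)  =
    row₃ primᵖ (gödel f) (gödel g) (gödel h) ∷ programRows g ++ programRows h
  programRows f@(mu g)      =
    row₂ muᵖ (gödel f) (gödel g) ∷ programRows g

  -- Finitely many rules must handle all indices, so the facts for a projection descend step by step
  -- to index 0.
  projRows : ℕ → List (Row ℕ)
  projRows zero    = row₁ projᵖ (encode (projᵖ ∷ 0 ∷ [])) ∷ []
  projRows (suc i) =
    row₂ projᵖ⁺ (encode (projᵖ ∷ suc i ∷ [])) (encode (projᵖ ∷ i ∷ [])) ∷ projRows i

  programRows* : ∀ {m n} → Vec (Rec n) m → List (Row ℕ)
  programRows* []           = row₁ nilᵖ (encode (nilᵖ ∷ [])) ∷ []
  programRows* fs@(g ∷ gs)  =
    row₃ consᵖ (gödel* fs) (gödel g) (gödel* gs) ∷ programRows g ++ programRows* gs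

-- The largest pair comes first, so that primitive recursion on codes can add each row in front.
chainRows : ℕ → List (Row ℕ)
chainRows zero    = []
chainRows (suc i) = row₂ succ i (suc i) ∷ chainRows i

codeRows : List (Row ℕ) → ℕ
codeRows rs = codeDatabase {𝕊} (List.map fact rs)

-- These rows do not mention the input, so their own code can be chosen as the input.
kernelRows : Rec 1 → List (Row ℕ)
kernelRows f = row₁ obj 0 ∷ row₁ start (gödel f) ∷ programRows f

inputRows : ℕ → List (Row ℕ) → List (Row ℕ)
inputRows n rs = row₁ input n ∷ chainRows n ++ rs

databaseFor : ℕ → Rec 1 → Database 𝕊
databaseFor n f = List.map fact (inputRows n (kernelRows f))

-- Soundness

-- Vacuously true if p is not the Gödel number of a function of arity length l, so
-- that the rules are sound without premises about arities.
Evaluates : ℕ → List ℕ → ℕ → Set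
Evaluates p l y = ∀ {n} (f : Rec n) xs → p ≡ gödel f → l ≡ toList xs → f [ xs ]⇓ y

Evaluates* : ℕ → List ℕ → List ℕ → Set
Evaluates* p l m = ∀ {k n} (fs : Vec (Rec n) k) xs → p ≡ gödel* fs → l ≡ toList xs →
                   ∃[ ys ] fs [ xs ]⇓* ys × m ≡ toList ys

Searched : ℕ → List ℕ → ℕ → Set
Searched p l k = ∀ {n} (f : Rec (suc n)) xs → p ≡ gödel f → l ≡ toList xs →
                 ∀ z → z < k → ∃[ w ] f [ z ∷ xs ]⇓ suc w

-- Injectivity of the coding reduces the claim to an equation between nodes; matching on it leaves
-- one constructor and identifies its immediate subprograms.
byNode : ∀ {p ns l y} → p ≡ encode ns →
         (∀ {n} (f : Rec n) xs → node f ≡ ns → l ≡ toList xs → f [ xs ]⇓ y) → Evaluates p l y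
byNode p≡ k f xs p≡f l≡ = k f xs (encode-injective (trans (sym p≡f) p≡)) l≡

byNode* : ∀ {p ns l m} → p ≡ encode ns →
          (∀ {k n} (fs : Vec (Rec n) k) xs → node* fs ≡ ns → l ≡ toList xs →
             ∃[ ys ] fs [ xs ]⇓* ys × m ≡ toList ys) → Evaluates* p l m
byNode* p≡ k f xs p≡f l≡ = k f xs (encode-injective (trans (sym p≡f) p≡)) l≡

proj-result : ∀ {n i y} {xs : Vec ℕ n} → proj i [ xs ]⇓ y → y ≡ lookup xs i
proj-result proj⇓ = refl

evaluates-zero : ∀ {p l} → p ≡ encode (zeroᵖ ∷ []) → Evaluates p l 0
evaluates-zero p≡ = byNode p≡ λ { zeroᵣ _ refl _ → zero⇓ }

evaluates-suc : ∀ {p x} → p ≡ encode (sucᵖ ∷ []) → Evaluates p (x ∷ []) (suc x)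
evaluates-suc p≡ = byNode p≡ λ { sucᵣ (_ ∷ []) refl refl → suc⇓ }

evaluates-proj : ∀ {p x l} → p ≡ encode (projᵖ ∷ 0 ∷ []) → Evaluates p (x ∷ l) x
evaluates-proj p≡ = byNode p≡ λ { (proj zero) (_ ∷ _) refl refl → proj⇓ }

evaluates-proj⁺ : ∀ {p q i x l y} → p ≡ encode (projᵖ ∷ suc i ∷ []) → q ≡ encode (projᵖ ∷ i ∷ []) →
                  Evaluates q l y → Evaluates p (x ∷ l) y
evaluates-proj⁺ p≡ q≡ q⇓ = byNode p≡ λ { (proj (suc i)) (_ ∷ xs) refl refl →
  subst (_ [ _ ]⇓_) (sym (proj-result (q⇓ (proj i) xs q≡ refl))) proj⇓ }

evaluates*-nil : ∀ {p l} → p ≡ encode (nilᵖ ∷ []) → Evaluates* p l []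
evaluates*-nil p≡ = byNode* p≡ λ { [] _ refl _ → [] , []⇓ , refl }

evaluates*-cons : ∀ {p f fs l y m} → p ≡ encode (consᵖ ∷ f ∷ fs ∷ []) →
                  Evaluates f l y → Evaluates* fs l m → Evaluates* p l (y ∷ m)
evaluates*-cons {y = y} p≡ f⇓ fs⇓ = byNode* p≡ λ { (f ∷ fs) xs refl l≡ →
  let ys , ds , m≡ = fs⇓ fs xs refl l≡
  in y ∷ ys , f⇓ f xs refl l≡ ∷⇓ ds , cong (y ∷_) m≡ }

evaluates-comp : ∀ {p f gs l m z} → p ≡ encode (compᵖ ∷ f ∷ gs ∷ []) →
                 Evaluates* gs l m → Evaluates f m z → Evaluates p l z
evaluates-comp p≡ gs⇓ f⇓ = byNode p≡ λ { (comp f gs) xs refl l≡ →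
  let ys , ds , m≡ = gs⇓ gs xs refl l≡ in comp⇓ ds (f⇓ f ys refl m≡) }

evaluates-prim₀ : ∀ {p f g l y} → p ≡ encode (primᵖ ∷ f ∷ g ∷ []) →
                  Evaluates f l y → Evaluates p (0 ∷ l) y
evaluates-prim₀ p≡ f⇓ = byNode p≡ λ { (prim f g) (_ ∷ xs) refl refl → prim⇓₀ (f⇓ f xs refl refl) }

evaluates-prim₊ : ∀ {p f g k l y z} → p ≡ encode (primᵖ ∷ f ∷ g ∷ []) →
                  Evaluates p (k ∷ l) y → Evaluates g (k ∷ y ∷ l) z → Evaluates p (suc k ∷ l) z
evaluates-prim₊ {k = k} {y = y} p≡ p⇓ g⇓ = byNode p≡ λ { (prim f g) (_ ∷ xs) refl refl →
  prim⇓₊ (p⇓ (prim f g) (k ∷ xs) p≡ refl) (g⇓ g (k ∷ y ∷ xs) refl refl) }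

searched-zero : ∀ {p l} → Searched p l 0
searched-zero _ _ _ _ _ ()

searched-suc : ∀ {p l k w} → Searched p l k → Evaluates p (k ∷ l) (suc w) → Searched p l (suc k)
searched-suc {k = k} {w} below p⇓ f xs p≡ l≡ z z<1+k with m<1+n⇒m<n∨m≡n z<1+k
... | inj₁ z<k  = below f xs p≡ l≡ z z<k
... | inj₂ refl = w , p⇓ f (k ∷ xs) p≡ (cong (k ∷_) l≡)

evaluates-mu : ∀ {p f l k} → p ≡ encode (muᵖ ∷ f ∷ []) →
               Searched f l k → Evaluates f (k ∷ l) 0 → Evaluates p l k
evaluates-mu {k = k} p≡ below f⇓ = byNode p≡ λ { (mu f) xs refl l≡ →
  mu⇓ (below f xs refl l≡) (f⇓ f (k ∷ xs) refl (cong (k ∷_) l≡)) }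

-- Every object is a number and a list at the same time, so that all objects have
-- successors and can be put in front of each other.
Object : Set
Object = ℕ × List ℕ

num : Object → ℕ
num = proj₁

lst : Object → List ℕ
lst = proj₂

module Intended (f₀ : Rec 1) (n₀ : ℕ) where

  -- The last clause makes `obj` and all numbers that are not tags hold everywhere; `goal` is read
  -- as the very statement that soundness has to yield.
  Fact : ℕ → Object → Object → Object → Set
  Fact succ   x y _ = num y ≡ suc (num x)
  Fact cons   x l m = lst m ≡ num x ∷ lst l
  Fact zeroᵖ  p _ _ = num p ≡ encode (zeroᵖ ∷ [])
  Fact sucᵖ   p _ _ = num p ≡ encode (sucᵖ ∷ [])
  Fact projᵖ  p _ _ = num p ≡ encode (projᵖ ∷ 0 ∷ [])
  Fact projᵖ⁺ p q _ = ∃[ i ] num p ≡ encode (projᵖ ∷ suc i ∷ [])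
                           × num q ≡ encode (projᵖ ∷ i ∷ [])
  Fact compᵖ  p f g = num p ≡ encode (compᵖ ∷ num f ∷ num g ∷ [])
  Fact primᵖ  p f g = num p ≡ encode (primᵖ ∷ num f ∷ num g ∷ [])
  Fact muᵖ    p f _ = num p ≡ encode (muᵖ ∷ num f ∷ [])
  Fact nilᵖ   p _ _ = num p ≡ encode (nilᵖ ∷ [])
  Fact consᵖ  p f g = num p ≡ encode (consᵖ ∷ num f ∷ num g ∷ [])
  Fact eval₁  p l y = Evaluates (num p) (lst l) (num y)
  Fact eval*  p l m = Evaluates* (num p) (lst l) (lst m)
  Fact search p l k = Searched (num p) (lst l) (num k)
  Fact start  p _ _ = num p ≡ gödel f₀
  Fact input  x _ _ = num x ≡ n₀
  Fact goal   _ _ _ = f₀ [ n₀ ∷ [] ]⇓ 0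
  Fact _      _ _ _ = ⊤

  HoldsRow : Row Object → Set
  HoldsRow (t ∷ x ∷ y ∷ z ∷ []) = Fact (num t) x y z

  intended : Structure 𝕊
  intended = record
    { Dom = Object
    -- As a number a constant is itself, as a list it is empty; so `con 0` is both zero and the
    -- empty list.
    ; ⟦_⟧ = _, []
    ; ⟦⟧-injective = λ { refl → refl }
    ; Holds = λ { (fact r) → HoldsRow r ; (guard _) → ⊤ }
    }

  valid : ∀ ρ → Valid intended (clauseOf ρ)
  -- In the witnesses for new objects, the component about which the head says nothing gets a
  -- default value, here `[]` and for `cons-exists` 0.
  valid succ-exists  (x ∷ []) _ = (suc (num x) , []) ∷ [] , refl
  valid succ-obj     (_ ∷ _ ∷ []) _ = [] , tt
  valid cons-exists  (x ∷ l ∷ []) _ = (0 , num x ∷ lst l) ∷ [] , refl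
  valid cons-obj     (_ ∷ _ ∷ _ ∷ []) _ = [] , tt
  valid zero-eval    (_ ∷ _ ∷ []) (p≡ ∷ _) = [] , evaluates-zero p≡
  valid suc-eval     (_ ∷ _ ∷ _ ∷ _ ∷ []) (p≡ ∷ refl ∷ refl ∷ []) = [] , evaluates-suc p≡
  valid proj-eval    (_ ∷ _ ∷ _ ∷ _ ∷ []) (p≡ ∷ refl ∷ []) = [] , evaluates-proj p≡
  valid proj⁺-eval   (_ ∷ _ ∷ _ ∷ _ ∷ _ ∷ _ ∷ []) ((i , p≡ , q≡) ∷ refl ∷ q⇓ ∷ []) =
    [] , evaluates-proj⁺ p≡ q≡ q⇓
  valid nil-eval     (_ ∷ _ ∷ []) (p≡ ∷ _) = [] , evaluates*-nil p≡
  valid cons-eval    (_ ∷ _ ∷ _ ∷ _ ∷ _ ∷ _ ∷ _ ∷ []) (p≡ ∷ f⇓ ∷ fs⇓ ∷ refl ∷ []) =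
    [] , evaluates*-cons p≡ f⇓ fs⇓
  valid comp-eval    (_ ∷ _ ∷ _ ∷ _ ∷ _ ∷ _ ∷ []) (p≡ ∷ gs⇓ ∷ f⇓ ∷ []) = [] , evaluates-comp p≡ gs⇓ f⇓
  valid prim-eval₀   (_ ∷ _ ∷ _ ∷ _ ∷ _ ∷ _ ∷ []) (p≡ ∷ refl ∷ f⇓ ∷ []) = [] , evaluates-prim₀ p≡ f⇓
  valid prim-eval₊   (_ ∷ _ ∷ _ ∷ _ ∷ _ ∷ _ ∷ _ ∷ _ ∷ _ ∷ _ ∷ _ ∷ _ ∷ [])
                     (p≡ ∷ refl ∷ p⇓ ∷ refl ∷ refl ∷ g⇓ ∷ refl ∷ refl ∷ []) = [] , evaluates-prim₊ p≡ p⇓ g⇓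
  valid search-start (_ ∷ _ ∷ _ ∷ []) _ = [] , searched-zero
  valid search-step  (_ ∷ _ ∷ _ ∷ _ ∷ _ ∷ _ ∷ _ ∷ []) (below ∷ refl ∷ f⇓ ∷ refl ∷ refl ∷ []) =
    [] , searched-suc below f⇓
  valid mu-eval      (_ ∷ _ ∷ _ ∷ _ ∷ _ ∷ []) (p≡ ∷ below ∷ refl ∷ f⇓ ∷ []) = [] , evaluates-mu p≡ below f⇓
  valid accept       (_ ∷ _ ∷ _ ∷ []) (p≡ ∷ x≡ ∷ refl ∷ p⇓ ∷ []) =
    [] , p⇓ f₀ (n₀ ∷ []) p≡ (cong (_∷ []) x≡)

  intended⊨Σᵤ : All (intended ⊨ᵀ_) Σᵤ
  intended⊨Σᵤ = (λ _ _ → [] , tt) ∷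
    map⁺ {P = intended ⊨ᵀ_} {f = tgd ∘ clauseOf} (All.universal models rules)
    where
    models : ∀ ρ → intended ⊨ᵀ tgd (clauseOf ρ)
    models ρ = valid⇒⊨ᵀ intended (clauseOf ρ) (valid ρ)

  TrueRow : Row ℕ → Set
  TrueRow r = HoldsRow (Vec.map (_, []) r)

  mutual
    programRows-true : ∀ {n} (f : Rec n) → All TrueRow (programRows f)
    programRows-true zeroᵣ       = refl ∷ []
    programRows-true sucᵣ        = refl ∷ []
    programRows-true (proj i)    = projRows-true (toℕ i)
    programRows-true (comp f gs) = refl ∷ All.++⁺ (programRows-true f) (programRows*-true gs)
    programRows-true (prim f g)  = refl ∷ All.++⁺ (programRows-true f) (programRows-true g)
    programRows-true (mu f)      = refl ∷ programRows-true f

    projRows-true : ∀ i → All TrueRow (projRows i)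
    projRows-true zero    = refl ∷ []
    projRows-true (suc i) = (i , refl , refl) ∷ projRows-true i

    programRows*-true : ∀ {m n} (fs : Vec (Rec n) m) → All TrueRow (programRows* fs)
    programRows*-true []       = refl ∷ []
    programRows*-true (f ∷ fs) = refl ∷ All.++⁺ (programRows-true f) (programRows*-true fs)

  chainRows-true : ∀ n → All TrueRow (chainRows n)
  chainRows-true zero    = []
  chainRows-true (suc i) = refl ∷ chainRows-true i

  intended⊨D : intended ⊨ᴰ databaseFor n₀ f₀
  intended⊨D = map⁺ (refl ∷ All.++⁺ (chainRows-true n₀) (tt ∷ refl ∷ programRows-true f₀))

  sound : Entails (databaseFor n₀ f₀) Σᵤ Q → f₀ [ n₀ ∷ [] ]⇓ 0
  sound entails = accepted (entails intended intended⊨D intended⊨Σᵤ)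
    where
    accepted : intended ⊨ᵠ Q → f₀ [ n₀ ∷ [] ]⇓ 0
    accepted (_ ∷ [] , goal⇓ ∷ []) = goal⇓

-- Completeness

Stored : (M : Structure 𝕊) → Row ℕ → Set
Stored M r = Holds M (fact (Vec.map ⟦ M ⟧ r))

module Completeness (f₀ : Rec 1) (n₀ : ℕ) (M : Structure 𝕊)
                    (given : All (Stored M) (inputRows n₀ (kernelRows f₀)))
                    (fire : ∀ ρ → Valid M (clauseOf ρ)) where

  private
    Known : Row (Dom M) → Set
    Known r = Holds M (fact r)

    c : ℕ → Dom M
    c = ⟦ M ⟧

    Obj : Dom M → Set
    Obj x = Known (row₁ (c obj) x)

    Succ : Dom M → Dom M → Set
    Succ x y = Known (row₂ (c succ) x y)

    Cons : Dom M → Dom M → Dom M → Set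
    Cons x l m = Known (row₃ (c cons) x l m)

    split : All (Stored M) (chainRows n₀) × All (Stored M) (kernelRows f₀)
    split = All.++⁻ (chainRows n₀) (All.tail given)

    obj-0 : Obj (c 0)
    obj-0 = All.head (proj₂ split)

    new-succ : ∀ x → Obj x → Σ[ y ∈ Dom M ] Succ x y
    new-succ x x-obj = lookup (proj₁ fired) zero , proj₂ fired
      where fired = fire succ-exists (x ∷ []) (x-obj ∷ [])

    succ⇒obj : ∀ {x y} → Succ x y → Obj y
    succ⇒obj {x} {y} x-succ = proj₂ (fire succ-obj (x ∷ y ∷ []) (x-succ ∷ []))

    new-cons : ∀ {x l} → Obj x → Obj l → Σ[ m ∈ Dom M ] Cons x l m
    new-cons {x} {l} x-obj l-obj = lookup (proj₁ fired) zero , proj₂ fired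
      where fired = fire cons-exists (x ∷ l ∷ []) (x-obj ∷ l-obj ∷ [])

    cons⇒obj : ∀ {x l m} → Cons x l m → Obj m
    cons⇒obj {x} {l} {m} m-cons = proj₂ (fire cons-obj (x ∷ l ∷ m ∷ []) (m-cons ∷ []))

  chain-succ : ∀ {n k} → All (Stored M) (chainRows n) → k < n → Succ (c k) (c (suc k))
  chain-succ {suc n} {k} (s ∷ ss) (s≤s k≤n) with ℕ.m≤n⇒m<n∨m≡n k≤n
  ... | inj₁ k<n  = chain-succ ss k<n
  ... | inj₂ refl = s

  -- A fixed choice of numerals is needed because numbers may have many successors;
  -- up to n₀ the constants are chosen, so that the input is a numeral.
  Numeral : ℕ → Set
  Numeral k = Σ[ x ∈ Dom M ] Obj x × (k ≤ n₀ → x ≡ c k)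

  next : ∀ {k} ((x , _) : Numeral k) → Σ[ (y , _) ∈ Numeral (suc k) ] Succ x y
  next {k} (x , x-obj , x≡) with suc k ℕ.≤? n₀
  ... | yes k<n₀ = (c (suc k) , succ⇒obj x-succ , λ _ → refl) , x-succ
    where
    x-succ : Succ x (c (suc k))
    x-succ = subst (λ x → Succ x (c (suc k))) (sym (x≡ (ℕ.<⇒≤ k<n₀))) (chain-succ (proj₁ split) k<n₀)
  ... | no k≮n₀ = (proj₁ y , succ⇒obj (proj₂ y) , λ k<n₀ → contradiction k<n₀ k≮n₀) , proj₂ y
    where y = new-succ x x-obj

  numerals : ∀ k → Numeral k
  numerals zero    = c 0 , obj-0 , λ _ → refl
  numerals (suc k) = proj₁ (next (numerals k))

  numeral : ℕ → Dom M
  numeral k = proj₁ (numerals k)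

  numeral-obj : ∀ k → Obj (numeral k)
  numeral-obj k = proj₁ (proj₂ (numerals k))

  numeral-succ : ∀ k → Succ (numeral k) (numeral (suc k))
  numeral-succ k = proj₂ (next (numerals k))

  consed : ∀ x ((l , _) : Σ (Dom M) Obj) → Σ[ (m , _) ∈ Σ (Dom M) Obj ] Cons (numeral x) l m
  consed x (l , l-obj) = (proj₁ m , cons⇒obj (proj₂ m)) , proj₂ m
    where m = new-cons (numeral-obj x) l-obj

  -- One object is fixed for each list, as for numerals, so that separately derived facts about a
  -- list share it.
  lists : ∀ {n} → Vec ℕ n → Σ (Dom M) Obj
  lists []       = c 0 , obj-0
  lists (x ∷ xs) = proj₁ (consed x (lists xs))

  list : ∀ {n} → Vec ℕ n → Dom M
  list xs = proj₁ (lists xs)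

  list-cons : ∀ {n} x (xs : Vec ℕ n) → Cons (numeral x) (list xs) (list (x ∷ xs))
  list-cons x xs = proj₂ (consed x (lists xs))

  private
    Eval Eval* Search : ∀ {n} → ℕ → Vec ℕ n → Dom M → Set
    Eval   p xs y = Known (row₃ (c eval₁) (c p) (list xs) y)
    Eval*  p xs y = Known (row₃ (c eval*) (c p) (list xs) y)
    Search p xs y = Known (row₃ (c search) (c p) (list xs) y)

  eval-proj : ∀ {n} (i : Fin n) (xs : Vec ℕ n) → All (Stored M) (projRows (toℕ i)) →
              Eval (gödel (proj i)) xs (numeral (lookup xs i))
  eval-proj zero    (x ∷ xs) (r ∷ _)  =
    proj₂ (fire proj-eval (c _ ∷ numeral x ∷ list xs ∷ list (x ∷ xs) ∷ []) (r ∷ list-cons x xs ∷ []))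
  eval-proj (suc i) (x ∷ xs) (r ∷ rs) =
    proj₂ (fire proj⁺-eval (c _ ∷ c _ ∷ numeral x ∷ list xs ∷ list (x ∷ xs) ∷ numeral (lookup xs i) ∷ [])
      (r ∷ list-cons x xs ∷ eval-proj i xs rs ∷ []))

  mutual
    -- Induction on the derivation: each of its rules is matched by a dependency, applied to the
    -- chosen numerals and lists.
    complete : ∀ {n} {f : Rec n} {xs y} → All (Stored M) (programRows f) → f [ xs ]⇓ y →
               Eval (gödel f) xs (numeral y)
    complete {xs = xs} (r ∷ _) zero⇓ =
      proj₂ (fire zero-eval (c _ ∷ list xs ∷ []) (r ∷ proj₂ (lists xs) ∷ []))
    complete (r ∷ _) (suc⇓ {x}) =
      proj₂ (fire suc-eval (c _ ∷ numeral x ∷ numeral (suc x) ∷ list (x ∷ []) ∷ [])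
        (r ∷ list-cons x [] ∷ numeral-succ x ∷ []))
    complete rs (proj⇓ {xs = xs} {i}) = eval-proj i xs rs
    complete {xs = xs} {z} (r ∷ rs) (comp⇓ {f = f} {gs} {ys = ys} ds d)
      with fs-given , gs-given ← All.++⁻ (programRows f) rs =
      proj₂ (fire comp-eval (c _ ∷ c _ ∷ c _ ∷ list xs ∷ list ys ∷ numeral z ∷ [])
        (r ∷ complete* gs-given ds ∷ complete fs-given d ∷ []))
    complete {y = y} (r ∷ rs) (prim⇓₀ {f = f} {xs = xs} d) =
      proj₂ (fire prim-eval₀ (c _ ∷ c _ ∷ c _ ∷ list xs ∷ list (0 ∷ xs) ∷ numeral y ∷ [])
        (r ∷ list-cons 0 xs ∷ complete (All.++⁻ˡ (programRows f) rs) d ∷ []))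
    -- The previous value belongs to the same program, so its derivation uses all of `rs′`.
    complete rs′@(r ∷ rs) (prim⇓₊ {f = f} {k = k} {xs} {y} {z} d e) =
      proj₂ (fire prim-eval₊
        (c _ ∷ c _ ∷ c _ ∷ numeral k ∷ numeral (suc k) ∷ list xs ∷ numeral y ∷ numeral z ∷
         list (k ∷ xs) ∷ list (y ∷ xs) ∷ list (k ∷ y ∷ xs) ∷ list (suc k ∷ xs) ∷ [])
        (r ∷ list-cons k xs ∷ complete rs′ d ∷ list-cons y xs ∷ list-cons k (y ∷ xs) ∷
         complete (All.++⁻ʳ (programRows f) rs) e ∷ numeral-succ k ∷ list-cons (suc k) xs ∷ []))
    complete (r ∷ rs) (mu⇓ {f = f} {xs} {y} below d) =
      proj₂ (fire mu-eval (c _ ∷ c _ ∷ list xs ∷ numeral y ∷ list (y ∷ xs) ∷ [])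
        (r ∷ searched y ℕ.≤-refl ∷ list-cons y xs ∷ complete rs d ∷ []))
      where
      searched : ∀ k → k ≤ y → Search (gödel f) xs (numeral k)
      searched zero    _   = proj₂ (fire search-start (c _ ∷ c _ ∷ list xs ∷ []) (r ∷ proj₂ (lists xs) ∷ []))
      searched (suc k) k<y = proj₂ (fire search-step
        (c _ ∷ list xs ∷ numeral k ∷ numeral (suc k) ∷ list (k ∷ xs) ∷
         numeral (proj₁ (below k k<y)) ∷ numeral (suc (proj₁ (below k k<y))) ∷ [])
        (searched k (ℕ.<⇒≤ k<y) ∷ list-cons k xs ∷ complete rs (proj₂ (below k k<y)) ∷
         numeral-succ _ ∷ numeral-succ k ∷ []))

    complete* : ∀ {m n} {fs : Vec (Rec n) m} {xs ys} → All (Stored M) (programRows* fs) → fs [ xs ]⇓* ys →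
                Eval* (gödel* fs) xs (list ys)
    complete* {xs = xs} (r ∷ _) []⇓ =
      proj₂ (fire nil-eval (c _ ∷ list xs ∷ []) (r ∷ proj₂ (lists xs) ∷ []))
    complete* {xs = xs} (r ∷ rs) (_∷⇓_ {f = f} {y = y} {ys = ys} d ds)
      with f-given , fs-given ← All.++⁻ (programRows f) rs =
      proj₂ (fire cons-eval
        (c _ ∷ c _ ∷ c _ ∷ list xs ∷ numeral y ∷ list ys ∷ list (y ∷ ys) ∷ [])
        (r ∷ complete f-given d ∷ complete* fs-given ds ∷ list-cons y ys ∷ []))

  accepts : f₀ [ n₀ ∷ [] ]⇓ 0 → M ⊨ᵠ Q
  accepts d with _ ∷ start-f₀ ∷ program ← proj₂ split =
    c (gödel f₀) ∷ [] ,
    proj₂ (fire accept (c (gödel f₀) ∷ numeral n₀ ∷ list (n₀ ∷ []) ∷ [])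
      (start-f₀ ∷ input-n₀ ∷ list-cons n₀ [] ∷ complete program d ∷ [])) ∷ []
    where
    input-n₀ : Known (row₁ (c input) (numeral n₀))
    input-n₀ = subst (λ x → Known (row₁ (c input) x))
      (sym (proj₂ (proj₂ (numerals n₀)) ℕ.≤-refl)) (All.head given)

obj-0-given : ∀ M n f → All (Stored M) (inputRows n (kernelRows f)) →
              Holds M (fact (row₁ (⟦ M ⟧ obj) (⟦ M ⟧ 0)))
obj-0-given M n f given = All.head {P = Stored M} (All.++⁻ʳ (chainRows n) (All.tail given))

complete : ∀ n f → f [ n ∷ [] ]⇓ 0 → Entails (databaseFor n f) Σᵤ Q
complete n f d M M⊨D (M⊨cross ∷ M⊨rules) =
  Completeness.accepts f n M given (λ ρ →
    ⊨ᵀ⇒valid M (obj-0-given M n f given) M⊨cross (clauseOf ρ)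
      (All.lookup M⊨rules (∈-map⁺ (tgd ∘ clauseOf) (∈-rules ρ)))) d
  where
  given : All (Stored M) (inputRows n (kernelRows f))
  given = map⁻ {P = Holds M ∘ mapAtom ⟦ M ⟧} M⊨D

-- The diagonal database

-- The first `zeroᵣ` is the index of the predicate of facts, the last one the code of the empty
-- list.
rowᵣ : ∀ {n} → ℕ → Rec n → Rec n → Rec n → Rec n
rowᵣ t f g h = comp pairᵣ (zeroᵣ ∷ (constᵣ t ∷ᵣ f ∷ᵣ g ∷ᵣ h ∷ᵣ zeroᵣ) ∷ [])

abstract
  rowCode : Row ℕ → ℕ
  rowCode r = pair 0 (codeList (toList r))

  codeRows-∷ : ∀ r rs → suc (pair (rowCode r) (codeRows rs)) ≡ codeRows (r ∷ rs)
  codeRows-∷ _ _ = refl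

  rowᵣ⇓ : ∀ {n t f g h} {xs : Vec ℕ n} {x y z} → f [ xs ]⇓ x → g [ xs ]⇓ y → h [ xs ]⇓ z →
          rowᵣ t f g h [ xs ]⇓ rowCode (t ∷ x ∷ y ∷ z ∷ [])
  rowᵣ⇓ {t = t} f⇓ g⇓ h⇓ =
    comp⇓ (zero⇓ ∷⇓ (∷ᵣ⇓ (constᵣ⇓ t) (∷ᵣ⇓ f⇓ (∷ᵣ⇓ g⇓ (∷ᵣ⇓ h⇓ zero⇓))) ∷⇓ []⇓))
          (pairᵣ⇓ 0 _)

∷ᵣ-rows : ∀ {n f g} {xs : Vec ℕ n} {r rs} → f [ xs ]⇓ rowCode r → g [ xs ]⇓ codeRows rs →
          (f ∷ᵣ g) [ xs ]⇓ codeRows (r ∷ rs)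
∷ᵣ-rows {f = f} {g} {xs} {r} {rs} f⇓ g⇓ =
  subst (λ c → (f ∷ᵣ g) [ xs ]⇓ c) (codeRows-∷ r rs) (∷ᵣ⇓ f⇓ g⇓)

-- The second argument is the code of the rows that the chain precedes; each step adds one cell to
-- the previous code.
chainᵣ : Rec 2
chainᵣ = prim (proj (# 0)) (rowᵣ succ i 1+i 1+i ∷ᵣ proj (# 1))
  where
  i 1+i : Rec 3
  i   = proj (# 0)
  1+i = comp sucᵣ (i ∷ [])

chainᵣ⇓ : ∀ n rs → chainᵣ [ n ∷ codeRows rs ∷ [] ]⇓ codeRows (chainRows n ++ rs)
chainᵣ⇓ zero    rs = prim⇓₀ proj⇓
chainᵣ⇓ (suc i) rs = prim⇓₊ (chainᵣ⇓ i rs)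
  (∷ᵣ-rows {r = row₂ succ i (suc i)} {chainRows i ++ rs} (rowᵣ⇓ proj⇓ 1+i⇓ 1+i⇓) proj⇓)
  where
  1+i⇓ = comp⇓ (proj⇓ ∷⇓ []⇓) suc⇓

-- The argument serves as the input, as the length of the chain and as the code of the remaining
-- rows; this is the self-application of the diagonal argument.
inputRowsᵣ : Rec 1
inputRowsᵣ = rowᵣ input n n n ∷ᵣ comp chainᵣ (n ∷ n ∷ [])
  where
  n : Rec 1
  n = proj (# 0)

inputRowsᵣ⇓ : ∀ rs → inputRowsᵣ [ codeRows rs ∷ [] ]⇓ codeRows (inputRows (codeRows rs) rs)
inputRowsᵣ⇓ rs = ∷ᵣ-rows {r = row₁ input (codeRows rs)} {chainRows (codeRows rs) ++ rs}
  (rowᵣ⇓ proj⇓ proj⇓ proj⇓)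
  (comp⇓ (proj⇓ ∷⇓ (proj⇓ ∷⇓ []⇓)) (chainᵣ⇓ (codeRows rs) rs))

-- Entailment is refuted first; then `f` must answer 0, and completeness gives entailment after all.
-- No case distinction on entailment is made.
entailment-undecidable : Undecidable codeDatabase (λ (D : Database 𝕊) → Entails D Σᵤ Q)
entailment-undecidable (f , decides) = not-entailed entailed
  where
  diagonal : Rec 1
  diagonal = comp f (inputRowsᵣ ∷ [])

  n₀ : ℕ
  n₀ = codeRows (kernelRows diagonal)

  D₀ : Database 𝕊
  D₀ = databaseFor n₀ diagonal

  rejects : diagonal [ n₀ ∷ [] ]⇓ 0 → f [ codeDatabase D₀ ∷ [] ]⇓ 0
  rejects (comp⇓ (d ∷⇓ []⇓) e) =
    -- By the choice of `n₀`, the value that `inputRowsᵣ` passes to `f` is the code of `D₀`.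
    subst (λ m → f [ m ∷ [] ]⇓ 0) (⇓-deterministic d (inputRowsᵣ⇓ (kernelRows diagonal))) e

  not-entailed : ¬ Entails D₀ Σᵤ Q
  not-entailed entails = contradiction
    (⇓-deterministic (proj₁ (decides D₀) entails)
                     (rejects (Intended.sound diagonal n₀ entails)))
    λ ()

  entailed : Entails D₀ Σᵤ Q
  entailed = complete n₀ diagonal
    (comp⇓ (inputRowsᵣ⇓ (kernelRows diagonal) ∷⇓ []⇓) (proj₂ (decides D₀) not-entailed))

theorem3p5 : Σ[ S ∈ Schema ] Σ[ Q ∈ BCQ S ] Σ[ Σᵤ ∈ List (TGD S) ]
    ( Atomic Q
    × GuardedExceptOne Σᵤ
    × Undecidable codeDatabase (λ (D : Database S) → Entails D Σᵤ Q)
    × ((D : Database S) (C : Chase D Σᵤ) → Entails D Σᵤ Q ⇔ (limit C ⊨ Q))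
    × ((chase : ChaseStrategy Σᵤ) → Undecidable codeDatabase (λ (D : Database S) → limit (chase D) ⊨ Q))
    )
theorem3p5 = 𝕊 , Q , Σᵤ , (_ , refl) , guardedExceptOne , entailment-undecidable , equivalent ,
  -- By the equivalence, a decider for the chase also decides entailment, whatever the strategy.
  λ { chase (f , decides) → entailment-undecidable (f , λ D →
        proj₁ (decides D) ∘ Equivalence.to (equivalent D (chase D)) ,
        λ ¬entailed → proj₂ (decides D) (¬entailed ∘ Equivalence.from (equivalent D (chase D)))) }
  where
  equivalent : (D : Database 𝕊) (C : Chase D Σᵤ) → Entails D Σᵤ Q ⇔ (limit C ⊨ Q)
  equivalent D = entails⇔chase D Σᵤ Q
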